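{- For every positive integer $z \neq 3$ there exists a graph $G$ with $\chi_c^\star(G)=z$, and there is no graph $G$ with $\chi_c^\star(G)=3$. That is, $\{\chi_c^\star(G) : G \text{ a finite graph}\}=\mathbb{Z}^+\setminus\{3\}$.
   Context: All graphs are finite and simple. For a graph $G$ and a positive integer $k$, a $k$-fold correspondence-cover of $G$ is a graph $H$ whose vertex set is partitioned into sets $L(v)=\{1_v,\dots,k_v\}$, $v\in V(G)$, such that each $L(v)$ is independent in $H$, there are no edges of $H$ between $L(u)$ and $L(v)$ when $uv\notin E(G)$, and for every edge $uv\in E(G)$ the edges of $H$ between $L(u)$ and $L(v)$ form a matching. A correspondence-colouring of $H$ is an independent set of $H$ containing exactly one vertex of each $L(v)$. A correspondence-packing of $H$ is a collection of $k$ pairwise disjoint correspondence-colourings of $H$ (so together they partition $V(H)$). The correspondence packing number $\chi_c^\star(G)$ is the least $k$ such that every $k$-fold correspondence-cover of $G$ admits a correspondence-packing. -}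

module Defs where

open import Data.Nat using (ℕ; _≤_; _<_)
open import Data.Fin using (Fin)
open import Data.Bool using (Bool; true; false)
open import Data.Product using (_×_)
open import Relation.Nullary using (¬_)
open import Relation.Binary.PropositionalEquality using (_≡_)

record Graph : Set where
  field
    n      : ℕ
    adj    : Fin n → Fin n → Bool
    irrefl : ∀ v → adj v v ≡ false
    sym    : ∀ u v → adj u v ≡ adj v u
open Graph public

-- A k-fold correspondence-cover H of G.  V(H) = {(v , i) : v ∈ V(G), i ∈ Fin k},
-- L(v) = {(v , i) : i}; (u , i)(v , j) is an edge of H iff  M u v i j ≡ true.
record Cover (G : Graph) (k : ℕ) : Set where
  field
    M       : Fin (n G) → Fin (n G) → Fin k → Fin k → Bool
    symm    : ∀ u v i j → M u v i j ≡ M v u j i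
    -- no edges between L(u) and L(v) when uv ∉ E(G)
    -- (in particular each L(v) is independent, as adj v v ≡ false)
    nonEdge : ∀ u v i j → adj G u v ≡ false → M u v i j ≡ false
    matchˡ  : ∀ u v i j j' → M u v i j ≡ true → M u v i j' ≡ true → j ≡ j'
    matchʳ  : ∀ u v i i' j → M u v i j ≡ true → M u v i' j ≡ true → i ≡ i'
open Cover public

IsColouring : {G : Graph} {k : ℕ} → Cover G k → (Fin (n G) → Fin k) → Set
IsColouring H c = ∀ u v → M H u v (c u) (c v) ≡ false

record Packing {G : Graph} {k : ℕ} (H : Cover G k) : Set where
  field
    col       : Fin k → Fin (n G) → Fin k
    colouring : ∀ a → IsColouring H (col a)
    disjoint  : ∀ a b v → col a v ≡ col b v → a ≡ b
open Packing public

Packable : Graph → ℕ → Set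
Packable G k = (H : Cover G k) → Packing H

IsCorrPackingNumber : Graph → ℕ → Set
IsCorrPackingNumber G k =
  (1 ≤ k) × Packable G k × (∀ j → 1 ≤ j → j < k → ¬ Packable G j)

{-# OPTIONS --safe #-}
module Submission where

-- The value 3 is skipped because the permutations of a 3-fold packing have a parity at
-- every vertex, and for a suitable 3-fold cover these parities solve a given 2-fold cover.
--
-- For the other values take d hubs and many stars, each leaf being also joined to all hubs,
-- so that leaves have degree d + 1. Permutations of the k colours chosen on the hubs and
-- centres fail to extend to a leaf only if its d + 1 matchings cover a block S × T with
-- |S|, |T| ≥ k ∸ d, which is impossible for k = 2d + 2. For k = 2d + 1 ≥ 5 such a block is
-- a Latin square whose position is determined by the hubs, so that a leaf excludes at most
-- d! permutations at its centre, and stars with (2d)!/d! leaves can be coloured. These are as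
-- many leaves as there are injections of d colourings into 2d colours, which is just enough
-- for Latin rectangles to refute a 2d-fold packing. In the same way (2d+1)!/d! leaves refute
-- a (2d+1)-fold one.

open import Defs renaming (sym to adj-sym)
open import Data.Nat.Properties using (+-0-commutativeMonoid)
open import Algebra.Properties.CommutativeMonoid.Sum +-0-commutativeMonoid using (sum; sum-permute; ∑-distrib-+)
open import Data.Bool using (Bool; true; false; not; if_then_else_; _∧_; _∨_)
import Data.Bool.Properties as Bool
open import Data.Empty using (⊥; ⊥-elim)
open import Data.Fin using (Fin; zero; suc; toℕ; fromℕ<; inject≤; splitAt; _↑ˡ_; _↑ʳ_; remQuot; combine; finToFun; funToFin; punchIn; punchOut; _≟_)
open import Data.Fin.Patterns using (0F; 1F; 2F)
open import Data.Fin.Permutation using (Permutation′; _⟨$⟩ʳ_; _⟨$⟩ˡ_; _∘ₚ_; inverseˡ; inverseʳ; transpose; insert; flip)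
  renaming (id to idₚ)
import Data.Fin.Permutation.Components as PC
open import Data.Fin.Properties hiding (_≟_)
open import Data.Nat using (ℕ; zero; suc; _+_; _*_; _^_; _%_; _!; _≤_; _<_; z≤n; s≤s; _≤′_; ≤′-refl; ≤′-step)
open import Data.Nat.DivMod using (%-distribˡ-+; [m+kn]%n≡m%n; m<n⇒m%n≡m; m%n<n)
import Data.Nat.Properties as ℕ
open import Data.Product using (Σ; ∃; _×_; _,_; proj₁; proj₂; uncurry)
open import Data.Sum using (_⊎_; inj₁; inj₂; [_,_]′)
open import Data.Sum.Function.Propositional using (_⊎-↔_)
open import Data.Unit using (⊤; tt)
open import Function using (_∘_; id)
open import Function.Bundles using (_↔_; Inverse)
open import Function.Construct.Composition using (_↔-∘_)
open import Function.Definitions using (Injective)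
open import Relation.Binary.PropositionalEquality
open import Relation.Nullary using (¬_; Dec; yes; no; contradiction)
open import Relation.Nullary.Decidable using (⌊_⌋; ¬?; _×-dec_; _⊎-dec_; _→-dec_; dec-true; dec-false; decidable-stable; toWitness)

⌊⌋-true : {P : Set} (P? : Dec P) → ⌊ P? ⌋ ≡ true → P
⌊⌋-true (yes p) _ = p

⌊⌋-intro : {P : Set} (P? : Dec P) → P → ⌊ P? ⌋ ≡ true
⌊⌋-intro (yes _) _ = refl
⌊⌋-intro (no ¬p) p = contradiction p ¬p

⌊⌋-false : {P : Set} (P? : Dec P) → ⌊ P? ⌋ ≡ false → ¬ P
⌊⌋-false (no ¬p) _ = ¬p

not-true : ∀ {b} → not b ≡ true → b ≡ false
not-true {false} _ = refl

injective⇒surjective : ∀ {n} (f : Fin n → Fin n) → Injective _≡_ _≡_ f → ∀ j → ∃ λ i → f i ≡ j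
injective⇒surjective {suc n} f f-inj j with any? (λ i → f i ≟ j)
... | yes hit = hit
... | no miss = contradiction
  (λ {x} {y} eq → f-inj (punchOut-injective (miss ∘ (x ,_) ∘ sym) (miss ∘ (y ,_) ∘ sym) eq))
  (<⇒notInjective (ℕ.n<1+n n))

permutation-injective : ∀ {n} (π : Permutation′ n) {i j} → π ⟨$⟩ʳ i ≡ π ⟨$⟩ʳ j → i ≡ j
permutation-injective π eq = trans (sym (inverseˡ π)) (trans (cong (π ⟨$⟩ˡ_) eq) (inverseˡ π))

-- Cardinality of Boolean subsets

card : ∀ {n} → (Fin n → Bool) → ℕ
card {zero}  B = 0
card {suc n} B = if B zero then suc (card (B ∘ suc)) else card (B ∘ suc)

enumerate : ∀ {n} (B : Fin n → Bool) →
            Σ (Fin (card B) → Fin n) λ e → Injective _≡_ _≡_ e × (∀ i → B (e i) ≡ true)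
enumerate {zero}  B = (λ ()) , (λ {}) , λ ()
enumerate {suc n} B with B zero in B0 | enumerate (B ∘ suc)
... | false | e , e-inj , Be = suc ∘ e , (λ eq → e-inj (suc-injective eq)) , Be
... | true  | e , e-inj , Be = e′ , e′-inj , Be′
  where
  e′ : Fin (suc (card (B ∘ suc))) → Fin (suc n)
  e′ zero    = zero
  e′ (suc i) = suc (e i)
  e′-inj : Injective _≡_ _≡_ e′
  e′-inj {zero}  {zero}  _  = refl
  e′-inj {suc i} {suc j} eq = cong suc (e-inj (suc-injective eq))
  Be′ : ∀ i → B (e′ i) ≡ true
  Be′ zero    = B0
  Be′ (suc i) = Be i

card-≤ : ∀ {n d} (B : Fin n → Bool) {R : Fin d → Fin n → Set} →
         (∀ i → B i ≡ true → ∃ λ l → R l i) →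
         (∀ l i j → R l i → R l j → i ≡ j) → card B ≤ d
card-≤ B {R} g R-inj with e , e-inj , Be ← enumerate B =
  injective⇒≤ {f = λ i → proj₁ (g (e i) (Be i))} λ {i} {j} eq →
    e-inj (R-inj _ _ _ (proj₂ (g (e i) (Be i))) (subst (λ l → R l (e j)) (sym eq) (proj₂ (g (e j) (Be j)))))

card-complement : ∀ {n} (B : Fin n → Bool) → card B + card (not ∘ B) ≡ n
card-complement {zero}  B = refl
card-complement {suc n} B with B zero | card-complement (B ∘ suc)
... | true  | eq = cong suc eq
... | false | eq = trans (ℕ.+-suc _ _) (cong suc eq)

-- The size `c` is prescribed, instead of being `card B`, so that pigeonhole arguments can compare
-- it directly with the number of matchings.
enumerate-large : ∀ {n d c} (B : Fin n → Bool) → d + c ≤ n → card (not ∘ B) ≤ d →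
                  Σ (Fin c → Fin n) λ e → Injective _≡_ _≡_ e × (∀ i → B (e i) ≡ true)
enumerate-large {n} {d} {c} B d+c≤n small with e , e-inj , Be ← enumerate B =
  (λ i → e (inject≤ i c≤)) , (λ eq → inject≤-injective c≤ c≤ _ _ (e-inj eq)) , λ i → Be _
  where
  open ℕ.≤-Reasoning
  c≤ : c ≤ card B
  c≤ = ℕ.+-cancelˡ-≤ d c (card B) (begin
    d + c                       ≤⟨ d+c≤n ⟩
    n                           ≡⟨ card-complement B ⟨
    card B + card (not ∘ B)     ≤⟨ ℕ.+-monoʳ-≤ (card B) small ⟩
    card B + d                  ≡⟨ ℕ.+-comm (card B) d ⟩
    d + card B                  ∎)

disjoint-injections : ∀ {a b n} {f : Fin a → Fin n} {g : Fin b → Fin n} →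
                      Injective _≡_ _≡_ f → Injective _≡_ _≡_ g → (∀ x y → f x ≢ g y) → a + b ≤ n
disjoint-injections {a} {b} {n} {f} {g} f-inj g-inj disj = injective⇒≤ both-inj
  where
  both : Fin (a + b) → Fin n
  both = [ f , g ]′ ∘ splitAt a
  both-inj : Injective _≡_ _≡_ both
  both-inj {x} {y} eq with splitAt a x in px | splitAt a y in py
  ... | inj₁ _ | inj₁ _ = trans (sym (splitAt⁻¹-↑ˡ px)) (trans (cong (_↑ˡ b) (f-inj eq)) (splitAt⁻¹-↑ˡ py))
  ... | inj₂ _ | inj₂ _ = trans (sym (splitAt⁻¹-↑ʳ px)) (trans (cong (a ↑ʳ_) (g-inj eq)) (splitAt⁻¹-↑ʳ py))
  ... | inj₁ u | inj₂ v = contradiction eq (disj u v)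
  ... | inj₂ u | inj₁ v = contradiction (sym eq) (disj v u)

transpose-left : ∀ {n} (i j : Fin n) → PC.transpose i j i ≡ j
transpose-left i j rewrite dec-true (i ≟ i) refl = refl

transpose-right : ∀ {n} (i j : Fin n) → PC.transpose i j j ≡ i
transpose-right i j with j ≟ i
... | yes refl = refl
... | no  _ rewrite dec-true (j ≟ j) refl = refl

transpose-other : ∀ {n} (i j : Fin n) {k} → k ≢ i → k ≢ j → PC.transpose i j k ≡ k
transpose-other i j {k} k≢i k≢j rewrite dec-false (k ≟ i) k≢i | dec-false (k ≟ j) k≢j = refl

-- Permutations avoiding d + 1 partial matchings

module Avoidance {d k : ℕ} (E : Fin (suc d) → Fin k → Fin k → Bool)
  (functionalˡ : ∀ l i j j′ → E l i j ≡ true → E l i j′ ≡ true → j ≡ j′)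
  (functionalʳ : ∀ l i i′ j → E l i j ≡ true → E l i′ j ≡ true → i ≡ i′) where

  F : Fin k → Fin k → Set
  F i j = ∃ λ l → E l i j ≡ true

  F? : ∀ i j → Dec (F i j)
  F? i j = any? λ l → E l i j Bool.≟ true

  record Block : Set where
    field
      S T     : Fin k → Bool
      S-large : card (not ∘ S) ≤ d
      T-large : card (not ∘ T) ≤ d
      full    : ∀ i j → S i ≡ true → T j ≡ true → F i j

  -- If a is bad and can be repaired neither by exchanging its image with
  -- that of some b, nor by a 3-cycle a ↦ π c, c ↦ π b, b ↦ π a, then the
  -- obstructions to these repairs form a block.
  repair : ∀ (π : Permutation′ k) a → Block ⊎
           ∃ λ (π′ : Permutation′ k) → ¬ F a (π′ ⟨$⟩ʳ a) ×
             (∀ c → ¬ F c (π ⟨$⟩ʳ c) → ¬ F c (π′ ⟨$⟩ʳ c))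
  repair π a with F? a (π ⟨$⟩ʳ a)
  ... | no ok = inj₂ (π , ok , λ _ → id)
  ... | yes bad with any? (λ b → ¬? (F? a (π ⟨$⟩ʳ b)) ×-dec ¬? (F? b (π ⟨$⟩ʳ a)))
  ...   | yes (b , ab , ba) = inj₂ (π′ , moved (transpose-left a b) ab , λ c → keep c (c ≟ a) (c ≟ b))
    where
    π′ = transpose a b ∘ₚ π
    moved : ∀ {c x y} → x ≡ y → ¬ F c (π ⟨$⟩ʳ y) → ¬ F c (π ⟨$⟩ʳ x)
    moved refl ok = ok
    keep : ∀ c → Dec (c ≡ a) → Dec (c ≡ b) → ¬ F c (π ⟨$⟩ʳ c) → ¬ F c (π′ ⟨$⟩ʳ c)
    keep c (yes refl) _          _  = moved (transpose-left c b) ab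
    keep c (no _)     (yes refl) _  = moved (transpose-right a c) ba
    keep c (no c≢a)   (no c≢b)   ok = moved (transpose-other a b c≢a c≢b) ok
  ...   | no noswap with any? (λ c → any? λ b →
            ¬? (F? a (π ⟨$⟩ʳ c)) ×-dec (¬? (F? b (π ⟨$⟩ʳ a)) ×-dec ¬? (F? c (π ⟨$⟩ʳ b))))
  ...     | yes (c , b , ac , ba , cb) = inj₂ (π′ , at-a , λ x → keep x (x ≟ a) (x ≟ c) (x ≟ b))
    where
    π′ = transpose a c ∘ₚ transpose a b ∘ₚ π
    c≢a : c ≢ a
    c≢a refl = ac bad
    b≢a : b ≢ a
    b≢a refl = ba bad
    c≢b : c ≢ b
    c≢b refl = noswap (b , ac , ba)
    moved : ∀ x {w y z} → PC.transpose a c x ≡ y → PC.transpose a b y ≡ z →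
            ¬ F w (π ⟨$⟩ʳ z) → ¬ F w (π′ ⟨$⟩ʳ x)
    moved _ refl refl ok = ok
    at-a : ¬ F a (π′ ⟨$⟩ʳ a)
    at-a = moved a (transpose-left a c) (transpose-other a b c≢a c≢b) ac
    keep : ∀ x → Dec (x ≡ a) → Dec (x ≡ c) → Dec (x ≡ b) → ¬ F x (π ⟨$⟩ʳ x) → ¬ F x (π′ ⟨$⟩ʳ x)
    keep x (yes refl) _          _          _  = at-a
    keep x (no _)     (yes refl) _          _  = moved c (transpose-right a c) (transpose-left a b) cb
    keep x (no _)     (no x≢c)   (yes refl) _  = moved b (transpose-other a c b≢a x≢c) (transpose-right a b) ba
    keep x (no x≢a)   (no x≢c)   (no x≢b)   ok =
      moved x (transpose-other a c x≢a x≢c) (transpose-other a b x≢a x≢b) ok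
  ...     | no norot = inj₁ record
    { S = λ i → ⌊ S? i ⌋ ; T = λ j → ⌊ T? j ⌋
    ; S-large = card-≤ _ S-out (λ _ _ _ x y → permutation-injective π (functionalˡ _ _ _ _ x y))
    ; T-large = card-≤ _ T-out (λ _ _ _ x y → permutation-injective (flip π) (functionalʳ _ _ _ _ x y))
    ; full = λ i j Si Tj → subst (F i) (inverseʳ π) (full′ i (π ⟨$⟩ˡ j) (⌊⌋-true (S? i) Si) (⌊⌋-true (T? j) Tj))
    }
    where
    -- `S` is `a` with the rows whose image `a` could take; `T` is the image of `a` with the images
    -- of the rows that could take it.
    S? : ∀ i → Dec (i ≡ a ⊎ ¬ F a (π ⟨$⟩ʳ i))
    S? i = i ≟ a ⊎-dec ¬? (F? a (π ⟨$⟩ʳ i))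
    T? : ∀ j → Dec (π ⟨$⟩ˡ j ≡ a ⊎ ¬ F (π ⟨$⟩ˡ j) (π ⟨$⟩ʳ a))
    T? j = π ⟨$⟩ˡ j ≟ a ⊎-dec ¬? (F? (π ⟨$⟩ˡ j) (π ⟨$⟩ʳ a))
    full′ : ∀ i b → i ≡ a ⊎ ¬ F a (π ⟨$⟩ʳ i) → b ≡ a ⊎ ¬ F b (π ⟨$⟩ʳ a) → F i (π ⟨$⟩ʳ b)
    full′ i b (inj₁ refl) (inj₁ refl) = bad
    full′ i b (inj₁ refl) (inj₂ ba)   = decidable-stable (F? i (π ⟨$⟩ʳ b)) λ ab → noswap (b , ab , ba)
    full′ i b (inj₂ ai)   (inj₁ refl) = decidable-stable (F? i (π ⟨$⟩ʳ b)) λ ib → noswap (i , ai , ib)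
    full′ i b (inj₂ ai)   (inj₂ ba)   = decidable-stable (F? i (π ⟨$⟩ʳ b)) λ ib → norot (i , b , ai , ba , ib)
    -- `la` is the matching that makes `a` bad. It has no second edge in row `a` or in column `π a`,
    -- so the rows outside `S` and the columns outside `T` are labelled injectively by the other `d`
    -- matchings.
    la : Fin (suc d)
    la = proj₁ bad
    S-out : ∀ i → not ⌊ S? i ⌋ ≡ true → ∃ λ l → E (punchIn la l) a (π ⟨$⟩ʳ i) ≡ true
    S-out i p with l , El ← decidable-stable (F? a (π ⟨$⟩ʳ i)) (⌊⌋-false (S? i) (not-true p) ∘ inj₂) =
      punchOut la≢l , subst (λ l → E l a (π ⟨$⟩ʳ i) ≡ true) (sym (punchIn-punchOut la≢l)) El
      where
      la≢l : la ≢ l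
      la≢l refl = ⌊⌋-false (S? i) (not-true p) (inj₁ (permutation-injective π
        (functionalˡ l a _ _ El (proj₂ bad))))
    T-out : ∀ j → not ⌊ T? j ⌋ ≡ true → ∃ λ l → E (punchIn la l) (π ⟨$⟩ˡ j) (π ⟨$⟩ʳ a) ≡ true
    T-out j p with l , El ← decidable-stable (F? (π ⟨$⟩ˡ j) (π ⟨$⟩ʳ a)) (⌊⌋-false (T? j) (not-true p) ∘ inj₂) =
      punchOut la≢l , subst (λ l → E l (π ⟨$⟩ˡ j) (π ⟨$⟩ʳ a) ≡ true) (sym (punchIn-punchOut la≢l)) El
      where
      la≢l : la ≢ l
      la≢l refl = ⌊⌋-false (T? j) (not-true p) (inj₁ (functionalʳ l _ _ _ El (proj₂ bad)))

  -- A repair never spoils a good row, so treating the rows one after another leaves all of them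
  -- good.
  repair-all : ∀ {m} (g : Fin m → Fin k) → Block ⊎
               ∃ λ (π : Permutation′ k) → ∀ i → ¬ F (g i) (π ⟨$⟩ʳ g i)
  repair-all {zero}  g = inj₂ (idₚ , λ ())
  repair-all {suc m} g with repair-all (g ∘ suc)
  ... | inj₁ block = inj₁ block
  ... | inj₂ (π , ok) with repair π (g zero)
  ...   | inj₁ block = inj₁ block
  ...   | inj₂ (π′ , ok₀ , keep) = inj₂ (π′ , λ { zero → ok₀ ; (suc i) → keep _ (ok i) })

  avoid : Block ⊎ ∃ λ (π : Permutation′ k) → ∀ l i → E l i (π ⟨$⟩ʳ i) ≡ false
  avoid with repair-all id
  ... | inj₁ block = inj₁ block
  ... | inj₂ (π , ok) = inj₂ (π , λ l i → Bool.¬-not λ eq → ok i (l , eq))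

  -- Some row of `S` would meet at least `d + 2` columns of `T`, but each of the `d + 1` matchings
  -- has at most one edge in it.
  no-block : suc d + suc d ≤ k → ¬ Block
  no-block 2d≤k b
    with s , _ , Ss ← enumerate-large {c = 1} (Block.S b) (ℕ.≤-trans (ℕ.+-mono-≤ (ℕ.n≤1+n d) (s≤s z≤n)) 2d≤k) (Block.S-large b)
       | e , e-inj , Te ← enumerate-large {c = suc (suc d)} (Block.T b) (ℕ.≤-trans (ℕ.≤-reflexive (ℕ.+-suc d (suc d))) 2d≤k) (Block.T-large b)
    = <⇒notInjective {f = proj₁ ∘ label} ℕ.≤-refl λ {i} {j} eq → e-inj (functionalˡ _ _ _ _ (proj₂ (label i))
        (subst (λ l → E l _ _ ≡ true) (sym eq) (proj₂ (label j))))
    where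
    label : ∀ i → F (s zero) (e i)
    label i = Block.full b _ _ (Ss zero) (Te i)

-- Rigidity of blocks when k = 2d + 1

-- The `n` labels hit at most one column each and cover `n` distinct columns, so labels and columns
-- correspond bijectively.
saturated : ∀ {n k} (R : Fin n → Fin k → Set) → (∀ l j j′ → R l j → R l j′ → j ≡ j′) →
            (e : Fin n → Fin k) → Injective _≡_ _≡_ e → (∀ i → ∃ λ l → R l (e i)) →
            (∀ l → ∃ λ i → R l (e i)) × (∀ l l′ j → R l j → R l′ j → l ≡ l′)
saturated R R-fun e e-inj cov = (λ l → proj₁ (onto l) , hit l) , unique
  where
  label : ∀ i → _
  label i = proj₁ (cov i)
  onto : ∀ l → ∃ λ i → label i ≡ l
  onto = injective⇒surjective label λ {i} {j} eq →
    e-inj (R-fun _ _ _ (proj₂ (cov i)) (subst (λ l → R l (e j)) (sym eq) (proj₂ (cov j))))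
  hit : ∀ l → R l (e (proj₁ (onto l)))
  hit l = subst (λ x → R x (e (proj₁ (onto l)))) (proj₂ (onto l)) (proj₂ (cov (proj₁ (onto l))))
  unique : ∀ l l′ j → R l j → R l′ j → l ≡ l′
  unique l l′ j r r′ = trans (sym (proj₂ (onto l))) (trans
    (cong label (e-inj (trans (R-fun _ _ _ (hit l) r) (R-fun _ _ _ r′ (hit l′)))))
    (proj₂ (onto l′)))

Family : ℕ → ℕ → Set
Family d k = Fin d → Fin k → Fin k → Bool

Functionalˡ Functionalʳ : ∀ {d k} → Family d k → Set
Functionalˡ E = ∀ l i j j′ → E l i j ≡ true → E l i j′ ≡ true → j ≡ j′
Functionalʳ E = ∀ l i i′ j → E l i j ≡ true → E l i′ j ≡ true → i ≡ i′

-- A Latin square with rows `S`, columns `T` and the `d + 1` matchings as symbols.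
record LatinBlock {d k : ℕ} (E : Family (suc d) k) : Set where
  field
    S T     : Fin k → Bool
    S-large : card (not ∘ S) ≤ d
    full    : ∀ i j → S i ≡ true → T j ≡ true → ∃ λ l → E l i j ≡ true
    row     : ∀ i → S i ≡ true → ∀ l → ∃ λ j → T j ≡ true × E l i j ≡ true
    unique  : ∀ i → S i ≡ true → ∀ l l′ j → E l i j ≡ true → E l′ i j ≡ true → l ≡ l′
    column  : ∀ j → T j ≡ true → ∀ l → ∃ λ i → S i ≡ true × E l i j ≡ true

-- `S` and `T` have at least `d + 1` elements, and each matching meets a row or column at most once,
-- so every line of the block is saturated.
latin : ∀ {d k} (E : Family (suc d) k) (Eˡ : Functionalˡ E) (Eʳ : Functionalʳ E) →
        k ≡ suc (d + d) → Avoidance.Block E Eˡ Eʳ → LatinBlock E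
latin {d} {k} E Eˡ Eʳ k≡ b = record
  { S = S ; T = T ; S-large = S-large ; full = full
  ; row    = λ i Si l → let onto = proj₁ (saturated-row i Si) l in
                        proj₁ T-enum (proj₁ onto) , proj₂ (proj₂ T-enum) _ , proj₂ onto
  ; unique = λ i Si → proj₂ (saturated-row i Si)
  ; column = λ j Tj l → let onto = proj₁ (saturated-column j Tj) l in
                        proj₁ S-enum (proj₁ onto) , proj₂ (proj₂ S-enum) _ , proj₂ onto
  }
  where
  open Avoidance.Block b
  d+1+d≤k : d + suc d ≤ k
  d+1+d≤k = ℕ.≤-reflexive (trans (ℕ.+-suc d d) (sym k≡))
  S-enum = enumerate-large {c = suc d} S d+1+d≤k S-large
  T-enum = enumerate-large {c = suc d} T d+1+d≤k T-large
  saturated-row = λ i (Si : S i ≡ true) → saturated (λ l j → E l i j ≡ true) (λ l → Eˡ l i)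
    (proj₁ T-enum) (proj₁ (proj₂ T-enum)) (λ c → full i _ Si (proj₂ (proj₂ T-enum) c))
  saturated-column = λ j (Tj : T j ≡ true) → saturated (λ l i → E l i j ≡ true) (λ l i i′ → Eʳ l i i′ j)
    (proj₁ S-enum) (proj₁ (proj₂ S-enum)) (λ c → full _ j (proj₂ (proj₂ S-enum) c) Tj)

large-sets-meet : ∀ {d k} → k ≡ suc (d + d) → (S S′ : Fin k → Bool) →
                  card (not ∘ S) ≤ d → card (not ∘ S′) ≤ d → ∃ λ i → S i ≡ true × S′ i ≡ true
large-sets-meet {d} refl S S′ large large′
  with e , e-inj , Se ← enumerate-large {c = suc d} S (ℕ.≤-reflexive (ℕ.+-suc d d)) large
     | e′ , e′-inj , Se′ ← enumerate-large {c = suc d} S′ (ℕ.≤-reflexive (ℕ.+-suc d d)) large′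
  with any? (λ x → any? λ y → e x ≟ e′ y)
... | yes (x , y , eq) = e x , Se x , trans (cong S′ eq) (Se′ y)
... | no disjoint = contradiction (disjoint-injections e-inj e′-inj λ x y eq → disjoint (x , y , eq))
  (ℕ.<⇒≱ (s≤s (ℕ.≤-reflexive (sym (ℕ.+-suc d d)))))

-- The constraints at a leaf, with rows indexing the colourings of the packing. The hubs carry the
-- identity, so `Y` enters unchanged; the centre carries `π`, which shifts its matching `X`.
twisted : ∀ {d k} → (Fin k → Fin k → Bool) → Family d k → Permutation′ k → Family (suc d) k
twisted X Y π zero    i j = X (π ⟨$⟩ʳ i) j
twisted X Y π (suc l) i j = Y l i j

module Twist {d k : ℕ} (X : Fin k → Fin k → Bool) (Y : Family d k)
  (Xˡ : ∀ i j j′ → X i j ≡ true → X i j′ ≡ true → j ≡ j′)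
  (Xʳ : ∀ i i′ j → X i j ≡ true → X i′ j ≡ true → i ≡ i′)
  (Yˡ : Functionalˡ Y) (Yʳ : Functionalʳ Y) where

  twistedˡ : ∀ π → Functionalˡ (twisted X Y π)
  twistedˡ π zero    i = Xˡ (π ⟨$⟩ʳ i)
  twistedˡ π (suc l) = Yˡ l

  twistedʳ : ∀ π → Functionalʳ (twisted X Y π)
  twistedʳ π zero    i i′ j p q = permutation-injective π (Xʳ _ _ j p q)
  twistedʳ π (suc l) = Yʳ l

  TwistBlock : Permutation′ k → Set
  TwistBlock π = Avoidance.Block (twisted X Y π) (twistedˡ π) (twistedʳ π)

  module _ (k≡ : k ≡ suc (d + d)) (2≤d : 2 ≤ d) {π ρ : Permutation′ k}
           (P : LatinBlock (twisted X Y π)) (R : LatinBlock (twisted X Y ρ)) where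
    private
      module P = LatinBlock P
      module R = LatinBlock R

      l₀ l₁ : Fin d
      l₀ = inject≤ zero 2≤d
      l₁ = inject≤ (suc zero) 2≤d

    -- Symbol `suc l` already occurs in column `j` of the block, and `Y l` has only one edge there.
    -- As `Y` does not depend on the permutation, this applies to hub edges found in the other block
    -- `P`.
    hit⇒row : ∀ {l i j} → R.T j ≡ true → Y l i j ≡ true → R.S i ≡ true
    hit⇒row {l} {j = j} Tj Yij with s , Ss , Ys ← R.column j Tj (suc l) =
      subst (λ s → R.S s ≡ true) (Yʳ l _ _ _ Ys Yij) Ss

    hit⇒column : ∀ {l i j} → R.S i ≡ true → Y l i j ≡ true → R.T j ≡ true
    hit⇒column {l} {i} Si Yij with t , Tt , Yt ← R.row i Si (suc l) =
      subst (λ t → R.T t ≡ true) (Yˡ l _ _ _ Yt Yij) Tt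

    -- The blocks share a row `a`, in which two hubs mark distinct columns `t₀` and `t₁` lying in
    -- both blocks. In row `i` the centre's matching covers at most one of them, so a hub edge
    -- covers the other and puts `i` into `R.S`. This is where two hubs are needed.
    rows-⊆ : ∀ i → P.S i ≡ true → R.S i ≡ true
    rows-⊆ i Si = go (large-sets-meet k≡ P.S R.S P.S-large R.S-large)
      where
      go : (∃ λ a → P.S a ≡ true × R.S a ≡ true) → R.S i ≡ true
      go (a , Pa , Ra) = compare (P.row a Pa (suc l₀)) (P.row a Pa (suc l₁))
        where
        compare : (∃ λ j → P.T j ≡ true × Y l₀ a j ≡ true) → (∃ λ j → P.T j ≡ true × Y l₁ a j ≡ true) →
                  R.S i ≡ true
        compare (t₀ , Pt₀ , Y₀) (t₁ , Pt₁ , Y₁) = cases (P.full i t₀ Si Pt₀) (P.full i t₁ Si Pt₁)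
          where
          cases : (∃ λ l → twisted X Y π l i t₀ ≡ true) → (∃ λ l → twisted X Y π l i t₁ ≡ true) →
                  R.S i ≡ true
          cases (suc l , Yi) _            = hit⇒row (hit⇒column Ra Y₀) Yi
          cases (zero , _)   (suc l , Yi) = hit⇒row (hit⇒column Ra Y₁) Yi
          cases (zero , X₀)  (zero , X₁)  = contradiction
            (inject≤-injective 2≤d 2≤d zero (suc zero) (suc-injective (P.unique a Pa (suc l₀) (suc l₁) t₀ Y₀
              (subst (λ t → Y l₁ a t ≡ true) (Xˡ _ _ _ X₁ X₀) Y₁))))
            λ ()

    columns-⊆ : ∀ j → P.T j ≡ true → R.T j ≡ true
    columns-⊆ j Tj with s , Ps , Ys ← P.column j Tj (suc l₀) = hit⇒column (rows-⊆ s Ps) Ys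

    -- A block determines X (π i), for i in S, as the one column of T not covered by Y.
    blocks-agree : ∀ i → P.S i ≡ true → π ⟨$⟩ʳ i ≡ ρ ⟨$⟩ʳ i
    blocks-agree i Si = go (P.row i Si zero)
      where
      go : (∃ λ t → P.T t ≡ true × X (π ⟨$⟩ʳ i) t ≡ true) → π ⟨$⟩ʳ i ≡ ρ ⟨$⟩ʳ i
      go (t , Tt , Xt) = cases (R.full i t (rows-⊆ i Si) (columns-⊆ t Tt))
        where
        cases : (∃ λ l → twisted X Y ρ l i t ≡ true) → π ⟨$⟩ʳ i ≡ ρ ⟨$⟩ʳ i
        cases (zero  , Xt′) = Xʳ _ _ t Xt Xt′
        cases (suc l , Yt)  = contradiction (P.unique i Si zero (suc l) t Xt Yt) λ ()

-- Counting permutations by their Lehmer codes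

Code : ℕ → Set
Code zero    = ⊤
Code (suc n) = Fin (suc n) × Code n

perm : ∀ {n} → Code n → Permutation′ n
perm {zero}  _       = idₚ
perm {suc n} (c , p) = insert zero c (perm p)

tally : ∀ {n} → (Code n → Bool) → ℕ
tally {zero}  B = if B tt then 1 else 0
tally {suc n} B = sum λ c → tally λ p → B (c , p)

sum-mono-≤ : ∀ {n} {f g : Fin n → ℕ} → (∀ i → f i ≤ g i) → sum f ≤ sum g
sum-mono-≤ {zero}  f≤g = z≤n
sum-mono-≤ {suc n} f≤g = ℕ.+-mono-≤ (f≤g zero) (sum-mono-≤ (f≤g ∘ suc))

sum-const : ∀ n c → sum {n} (λ _ → c) ≡ n * c
sum-const zero    c = refl
sum-const (suc n) c = cong (c +_) (sum-const n c)

sum-if : ∀ {n} (B : Fin n → Bool) c → sum (λ i → if B i then c else 0) ≡ card B * c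
sum-if {zero}  B c = refl
sum-if {suc n} B c with B zero
... | true  = cong (c +_) (sum-if (B ∘ suc) c)
... | false = sum-if (B ∘ suc) c

member : ∀ {n} (B : Code n → Bool) → tally B ≢ 0 → ∃ λ p → B p ≡ true
member {zero} B ≢0 with B tt in eq
... | true  = tt , eq
... | false = contradiction refl ≢0
member {suc n} B ≢0 with any? (λ c → ¬? (tally (λ p → B (c , p)) ℕ.≟ 0))
... | yes (c , c≢0) with p , Bp ← member _ c≢0 = (c , p) , Bp
... | no all-0 = contradiction (ℕ.n≤0⇒n≡0 (begin
  tally B               ≤⟨ sum-mono-≤ (λ c → ℕ.≤-reflexive (decidable-stable (_ ℕ.≟ 0) (all-0 ∘ (c ,_)))) ⟩
  sum {suc n} (λ _ → 0) ≡⟨ sum-const (suc n) 0 ⟩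
  suc n * 0             ≡⟨ ℕ.*-zeroʳ (suc n) ⟩
  0                     ∎)) ≢0
  where open ℕ.≤-Reasoning

-- Members of `B` differ only in how they distribute the remaining `card U` values over `U`. The
-- induction is on the first position.
tally-agree : ∀ {n} (B : Code n → Bool) (U : Fin n → Bool) →
              (∀ p q → B p ≡ true → B q ≡ true → ∀ i → U i ≡ false → perm p ⟨$⟩ʳ i ≡ perm q ⟨$⟩ʳ i) →
              tally B ≤ card U !
tally-agree {zero} B U agree with B tt
... | true  = ℕ.≤-refl
... | false = z≤n
tally-agree {suc n} B U agree with tally B ℕ.≟ 0
... | yes ≡0 = ℕ.≤-trans (ℕ.≤-reflexive ≡0) z≤n
... | no  ≢0 with (c₀ , p₀) , B₀ ← member B ≢0 = bound (U zero) refl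
  where
  open ℕ.≤-Reasoning
  V = U ∘ suc
  K = card V !
  π₀ = perm (c₀ , p₀)
  rest : ∀ c → tally (λ p → B (c , p)) ≤ K
  rest c = tally-agree _ V λ p q Bp Bq i Ui → punchIn-injective c _ _ (agree (c , p) (c , q) Bp Bq (suc i) Ui)
  if-bound : ∀ c b → (b ≡ false → ∀ p → B (c , p) ≡ true → ⊥) →
             tally (λ p → B (c , p)) ≤ (if b then K else 0)
  if-bound c true  _    = rest c
  if-bound c false none with tally (λ p → B (c , p)) ℕ.≟ 0
  ... | yes ≡0 = ℕ.≤-reflexive ≡0
  ... | no  ≢0 with p , Bp ← member _ ≢0 = ⊥-elim (none refl p Bp)
  bound : ∀ u → U zero ≡ u → tally B ≤ card U !
  bound false U₀ = begin
    tally B                                          ≤⟨ sum-mono-≤ (λ c → if-bound c ⌊ c ≟ c₀ ⌋ λ c≢ p Bp →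
                                                          ⌊⌋-false (c ≟ c₀) c≢ (agree (c , p) (c₀ , p₀) Bp B₀ zero U₀)) ⟩
    sum (λ c → if ⌊ c ≟ c₀ ⌋ then K else 0)          ≡⟨ sum-if (λ c → ⌊ c ≟ c₀ ⌋) K ⟩
    card (λ c → ⌊ c ≟ c₀ ⌋) * K                      ≤⟨ ℕ.*-monoˡ-≤ K (card-≤ {d = 1} _ {R = λ _ c → c ≡ c₀}
                                                          (λ c c≡ → zero , ⌊⌋-true (c ≟ c₀) c≡) (λ _ _ _ p q → trans p (sym q))) ⟩
    1 * K                                            ≡⟨ ℕ.*-identityˡ K ⟩
    K                                                ≡⟨ cong (λ u → (if u then suc (card V) else card V) !) U₀ ⟨
    card U !                                         ∎
  -- A value `π₀ i` with `i` outside `U` is taken at `i` by every member, hence never at `zero`.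
  -- Reindexing by `π₀` leaves `card U` possible first values.
  bound true U₀ = begin
    tally B                                          ≤⟨ sum-mono-≤ (λ c → if-bound c (U (π₀ ⟨$⟩ˡ c)) (none c (π₀ ⟨$⟩ˡ c) (inverseʳ π₀))) ⟩
    sum (λ c → if U (π₀ ⟨$⟩ˡ c) then K else 0)       ≡⟨ sum-permute (λ i → if U i then K else 0) (flip π₀) ⟨
    sum (λ i → if U i then K else 0)                 ≡⟨ sum-if U K ⟩
    card U * K                                       ≡⟨ cong (λ u → (if u then suc (card V) else card V) * K) U₀ ⟩
    suc (card V) !                                   ≡⟨ cong (λ u → (if u then suc (card V) else card V) !) U₀ ⟨
    card U !                                         ∎
    where
    none : ∀ c i → π₀ ⟨$⟩ʳ i ≡ c → U i ≡ false → ∀ p → B (c , p) ≡ true → ⊥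
    none c zero    _   Ui p Bp = contradiction (trans (sym U₀) Ui) λ ()
    none c (suc i) eq Ui p Bp = punchInᵢ≢i c _ (trans (agree (c , p) (c₀ , p₀) Bp B₀ (suc i) Ui) eq)

tally-∨ : ∀ {n} (B C : Code n → Bool) → tally (λ p → B p ∨ C p) ≤ tally B + tally C
tally-∨ {zero} B C with B tt | C tt
... | true  | true  = s≤s z≤n
... | true  | false = ℕ.≤-refl
... | false | _     = ℕ.≤-refl
tally-∨ {suc n} B C = ℕ.≤-trans (sum-mono-≤ λ c → tally-∨ (λ p → B (c , p)) (λ p → C (c , p)))
  (ℕ.≤-reflexive (∑-distrib-+ (λ c → tally λ p → B (c , p)) (λ c → tally λ p → C (c , p))))

non-member : ∀ {n} (B : Code n → Bool) → tally B < n ! → ∃ λ p → B p ≡ false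
non-member {zero} B small with B tt in eq
... | true  = contradiction small ℕ.1+n≰n
... | false = tt , eq
non-member {suc n} B small with any? (λ c → tally (λ p → B (c , p)) ℕ.<? n !)
... | yes (c , c-small) with p , Bp ← non-member _ c-small = (c , p) , Bp
... | no all-big = contradiction small (ℕ.≤⇒≯ (begin
  suc n * n !             ≡⟨ sum-const (suc n) (n !) ⟨
  sum {suc n} (λ _ → n !) ≤⟨ sum-mono-≤ (λ c → ℕ.≮⇒≥ (all-big ∘ (c ,_))) ⟩
  tally B                 ∎))
  where open ℕ.≤-Reasoning

⋁ : ∀ {n m} → (Fin m → Code n → Bool) → Code n → Bool
⋁ {m = zero}  B p = false
⋁ {m = suc m} B p = B zero p ∨ ⋁ (B ∘ suc) p

tally-empty : ∀ n → tally {n} (λ _ → false) ≡ 0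
tally-empty n with tally {n} (λ _ → false) ℕ.≟ 0
... | yes ≡0 = ≡0
... | no  ≢0 with () ← proj₂ (member {n} _ ≢0)

tally-⋁ : ∀ {n m K} (B : Fin m → Code n → Bool) → (∀ w → tally (B w) ≤ K) → tally (⋁ B) ≤ m * K
tally-⋁ {n} {zero}  B small = ℕ.≤-reflexive (tally-empty n)
tally-⋁ {n} {suc m} B small =
  ℕ.≤-trans (tally-∨ (B zero) _) (ℕ.+-mono-≤ (small zero) (tally-⋁ (B ∘ suc) (small ∘ suc)))

⋁-false : ∀ {n m} (B : Fin m → Code n → Bool) p → ⋁ B p ≡ false → ∀ w → B w p ≡ false
⋁-false B p eq zero with B zero p
... | false = refl
⋁-false B p eq (suc w) with B zero p
... | false = ⋁-false (B ∘ suc) p eq w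

-- A union bound: the sets together contain fewer than `n !` codes.
avoid-all : ∀ {n m K} (B : Fin m → Code n → Bool) → (∀ w → tally (B w) ≤ K) → m * K < n ! →
            ∃ λ p → ∀ w → B w p ≡ false
avoid-all B small mK< with p , Op ← non-member (⋁ B) (ℕ.≤-<-trans (tally-⋁ B small) mK<) =
  p , ⋁-false B p Op

-- Injections, coded by falling factorials

fall : ℕ → ℕ → ℕ
fall n       zero    = 1
fall zero    (suc s) = 0
fall (suc n) (suc s) = suc n * fall n s

fall-! : ∀ s d → fall (s + d) s * d ! ≡ (s + d) !
fall-! zero    d = ℕ.*-identityˡ (d !)
fall-! (suc s) d = trans (ℕ.*-assoc (suc (s + d)) (fall (s + d) s) (d !)) (cong (suc (s + d) *_) (fall-! s d))

prepend : ∀ {n s} → Fin (suc n) → (Fin s → Fin n) → Fin (suc s) → Fin (suc n)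
prepend c f zero    = c
prepend c f (suc i) = punchIn c (f i)

prepend-injective : ∀ {n s} c (f : Fin s → Fin n) → Injective _≡_ _≡_ f → Injective _≡_ _≡_ (prepend c f)
prepend-injective c f f-inj {zero}  {zero}  _  = refl
prepend-injective c f f-inj {zero}  {suc j} eq = contradiction (sym eq) (punchInᵢ≢i _ _)
prepend-injective c f f-inj {suc i} {zero}  eq = contradiction eq (punchInᵢ≢i _ _)
prepend-injective c f f-inj {suc i} {suc j} eq = cong suc (f-inj (punchIn-injective c _ _ eq))

decode : ∀ n s → Fin (fall n s) → Fin s → Fin n
decode (suc n) (suc s) q = uncurry (λ c p → prepend c (decode n s p)) (remQuot {suc n} (fall n s) q)

decode-injective : ∀ n s q → Injective _≡_ _≡_ (decode n s q)
decode-injective n       zero    q {()}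
decode-injective (suc n) (suc s) q = prepend-injective _ _ (decode-injective n s _)

-- Guarantees that, whatever injections a packing induces, a star and a leaf have been built for
-- them.
decode-onto : ∀ n s (f : Fin s → Fin n) → Injective _≡_ _≡_ f → ∃ λ q → ∀ i → decode n s q i ≡ f i
decode-onto n       zero    f f-inj = zero , λ ()
decode-onto zero    (suc s) f f-inj = contradiction (f zero) λ ()
decode-onto (suc n) (suc s) f f-inj = combine (f zero) (proj₁ rest) , values
  where
  f₀≢ : ∀ i → f zero ≢ f (suc i)
  f₀≢ i eq = contradiction (f-inj eq) λ ()
  rest : ∃ λ q → ∀ i → decode n s q i ≡ punchOut (f₀≢ i)
  rest = decode-onto n s (λ i → punchOut (f₀≢ i))
    λ {i} {j} eq → suc-injective (f-inj (punchOut-injective (f₀≢ i) (f₀≢ j) eq))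
  tail-values : ∀ i → prepend (f zero) (decode n s (proj₁ rest)) i ≡ f i
  tail-values zero    = refl
  tail-values (suc i) = trans (cong (punchIn (f zero)) (proj₂ rest i)) (punchIn-punchOut (f₀≢ i))
  values : ∀ i → decode (suc n) (suc s) (combine (f zero) (proj₁ rest)) i ≡ f i
  values i = trans (cong (λ cp → uncurry (λ c p → prepend c (decode n s p)) cp i)
                         (remQuot-combine (f zero) (proj₁ rest)))
                   (tail-values i)

-- The cyclic Latin square

cyclic : ∀ {d} → Fin (suc d) → Fin (suc d) → Fin (suc d)
cyclic {d} r l = fromℕ< (m%n<n (toℕ r + toℕ l) (suc d))

cyclic-comm : ∀ {d} (r l : Fin (suc d)) → cyclic r l ≡ cyclic l r
cyclic-comm {d} r l = fromℕ<-cong _ _ (cong (_% suc d) (ℕ.+-comm (toℕ r) (toℕ l))) _ _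

-- Adding `d * r` undoes adding `r`, as together they make a multiple of `suc d`.
cyclic-injective : ∀ {d} (r : Fin (suc d)) → Injective _≡_ _≡_ (cyclic r)
cyclic-injective {d} r {l} {l′} eq = toℕ-injective (begin
  toℕ l                                            ≡⟨ undo l ⟨
  ((toℕ r + toℕ l) % suc d + d * toℕ r % suc d) % suc d
    ≡⟨ cong (λ x → (x + d * toℕ r % suc d) % suc d) (fromℕ<-injective _ _ (m%n<n (toℕ r + toℕ l) (suc d)) (m%n<n (toℕ r + toℕ l′) (suc d)) eq) ⟩
  ((toℕ r + toℕ l′) % suc d + d * toℕ r % suc d) % suc d ≡⟨ undo l′ ⟩
  toℕ l′                                           ∎)
  where
  open ≡-Reasoning
  undo : ∀ l → ((toℕ r + toℕ l) % suc d + d * toℕ r % suc d) % suc d ≡ toℕ l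
  undo l = begin
    ((toℕ r + toℕ l) % suc d + d * toℕ r % suc d) % suc d ≡⟨ %-distribˡ-+ (toℕ r + toℕ l) (d * toℕ r) (suc d) ⟨
    (toℕ r + toℕ l + d * toℕ r) % suc d                   ≡⟨ cong (_% suc d) (trans (cong (_+ d * toℕ r) (ℕ.+-comm (toℕ r) (toℕ l)))
                                                              (ℕ.+-assoc (toℕ l) (toℕ r) (d * toℕ r))) ⟩
    (toℕ l + suc d * toℕ r) % suc d                       ≡⟨ cong (λ x → (toℕ l + x) % suc d) (ℕ.*-comm (suc d) (toℕ r)) ⟩
    (toℕ l + toℕ r * suc d) % suc d                       ≡⟨ [m+kn]%n≡m%n (toℕ l) (toℕ r) (suc d) ⟩
    toℕ l % suc d                                         ≡⟨ m<n⇒m%n≡m (toℕ<n l) ⟩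
    toℕ l                                                 ∎

-- Packing numbers

-- Deleting one colour everywhere and packing the rest gives a colouring `c₀`. Deleting `c₀` instead
-- leaves another cover to pack, and `c₀` completes that packing.
packable-suc : ∀ {G k} → 1 ≤ k → Packable G k → Packable G (suc k)
packable-suc {G} {suc k} (s≤s _) pack H = record
  { col       = colour
  ; colouring = λ { zero → first ; (suc a) → colouring (pack rest) a }
  ; disjoint  = disj
  }
  where
  restrict : (Fin (n G) → Fin (suc (suc k))) → Cover G (suc k)
  restrict c = record
    { M       = λ u v i j → M H u v (punchIn (c u) i) (punchIn (c v) j)
    ; symm    = λ u v i j → symm H u v _ _
    ; nonEdge = λ u v i j → nonEdge H u v _ _
    ; matchˡ  = λ u v i j j′ p q → punchIn-injective (c v) j j′ (matchˡ H u v _ _ _ p q)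
    ; matchʳ  = λ u v i i′ j p q → punchIn-injective (c u) i i′ (matchʳ H u v _ _ _ p q)
    }
  c₀ : Fin (n G) → Fin (suc (suc k))
  c₀ v = punchIn zero (col (pack (restrict λ _ → zero)) zero v)
  first : IsColouring H c₀
  first = colouring (pack (restrict λ _ → zero)) zero
  rest = restrict c₀
  colour : Fin (suc (suc k)) → Fin (n G) → Fin (suc (suc k))
  colour zero    v = c₀ v
  colour (suc a) v = punchIn (c₀ v) (col (pack rest) a v)
  disj : ∀ a b v → colour a v ≡ colour b v → a ≡ b
  disj zero    zero    v _  = refl
  disj zero    (suc b) v eq = contradiction (sym eq) (punchInᵢ≢i _ _)
  disj (suc a) zero    v eq = contradiction eq (punchInᵢ≢i _ _)
  disj (suc a) (suc b) v eq = cong suc (disjoint (pack rest) a b v (punchIn-injective _ _ _ eq))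

packable-≤ : ∀ {G j k} → 1 ≤ j → j ≤ k → Packable G j → Packable G k
packable-≤ {G} {j} 1≤j j≤k pack = go (ℕ.≤⇒≤′ j≤k)
  where
  go : ∀ {k} → j ≤′ k → Packable G k
  go ≤′-refl       = pack
  go (≤′-step j≤k) = packable-suc (ℕ.≤-trans 1≤j (ℕ.≤′⇒≤ j≤k)) (go j≤k)

-- By monotonicity, failure at `k` rules out all smaller positive values.
packing-number : ∀ {G k} → Packable G (suc k) → ¬ Packable G k → IsCorrPackingNumber G (suc k)
packing-number pack ¬pack = s≤s z≤n , pack , λ { j 1≤j (s≤s j≤k) packⱼ → ¬pack (packable-≤ 1≤j j≤k packⱼ) }

-- Bipartite graphs and their covers

module Bipartite {A B : Set} {size : ℕ} (vertices : Fin size ↔ (A ⊎ B)) (inc : A → B → Bool) where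

  open Inverse vertices using (to; from; strictlyInverseˡ; strictlyInverseʳ)

  incident : A ⊎ B → A ⊎ B → Bool
  incident (inj₁ a) (inj₂ b) = inc a b
  incident (inj₂ b) (inj₁ a) = inc a b
  incident (inj₁ _) (inj₁ _) = false
  incident (inj₂ _) (inj₂ _) = false

  graph : Graph
  graph = record
    { n      = size
    ; adj    = λ u v → incident (to u) (to v)
    ; irrefl = λ v → loopless (to v)
    ; sym    = λ u v → symmetric (to u) (to v)
    }
    where
    loopless : ∀ x → incident x x ≡ false
    loopless (inj₁ _) = refl
    loopless (inj₂ _) = refl
    symmetric : ∀ x y → incident x y ≡ incident y x
    symmetric (inj₁ _) (inj₁ _) = refl
    symmetric (inj₁ _) (inj₂ _) = refl
    symmetric (inj₂ _) (inj₁ _) = refl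
    symmetric (inj₂ _) (inj₂ _) = refl

  module _ {k : ℕ} (K : A → B → Fin k → Fin k → Bool)
    (K-inc : ∀ a b i j → inc a b ≡ false → K a b i j ≡ false)
    (Kˡ : ∀ a b i j j′ → K a b i j ≡ true → K a b i j′ ≡ true → j ≡ j′)
    (Kʳ : ∀ a b i i′ j → K a b i j ≡ true → K a b i′ j ≡ true → i ≡ i′) where

    edges : A ⊎ B → A ⊎ B → Fin k → Fin k → Bool
    edges (inj₁ a) (inj₂ b) i j = K a b i j
    edges (inj₂ b) (inj₁ a) i j = K a b j i
    edges (inj₁ _) (inj₁ _) i j = false
    edges (inj₂ _) (inj₂ _) i j = false

    cover : Cover graph k
    cover = record
      { M       = λ u v → edges (to u) (to v)
      ; symm    = λ u v → symmetric (to u) (to v)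
      ; nonEdge = λ u v → non-edge (to u) (to v)
      ; matchˡ  = λ u v → matchingˡ (to u) (to v)
      ; matchʳ  = λ u v → matchingʳ (to u) (to v)
      }
      where
      symmetric : ∀ x y i j → edges x y i j ≡ edges y x j i
      symmetric (inj₁ _) (inj₁ _) _ _ = refl
      symmetric (inj₁ _) (inj₂ _) _ _ = refl
      symmetric (inj₂ _) (inj₁ _) _ _ = refl
      symmetric (inj₂ _) (inj₂ _) _ _ = refl
      non-edge : ∀ x y i j → incident x y ≡ false → edges x y i j ≡ false
      non-edge (inj₁ _) (inj₁ _) _ _ _  = refl
      non-edge (inj₁ a) (inj₂ b) i j eq = K-inc a b i j eq
      non-edge (inj₂ b) (inj₁ a) i j eq = K-inc a b j i eq
      non-edge (inj₂ _) (inj₂ _) _ _ _  = refl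
      matchingˡ : ∀ x y i j j′ → edges x y i j ≡ true → edges x y i j′ ≡ true → j ≡ j′
      matchingˡ (inj₁ a) (inj₂ b) = Kˡ a b
      matchingˡ (inj₂ b) (inj₁ a) i j j′ = Kʳ a b j j′ i
      matchingʳ : ∀ x y i i′ j → edges x y i j ≡ true → edges x y i′ j ≡ true → i ≡ i′
      matchingʳ (inj₁ a) (inj₂ b) = Kʳ a b
      matchingʳ (inj₂ b) (inj₁ a) i i′ j = Kˡ a b j i i′

    cover-edge : ∀ a b i j → M cover (from (inj₁ a)) (from (inj₂ b)) i j ≡ K a b i j
    cover-edge a b i j rewrite strictlyInverseˡ (inj₁ a) | strictlyInverseˡ (inj₂ b) = refl

  -- A packing amounts to a permutation of the colours at every vertex, whose injectivity is the
  -- disjointness.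
  packing : ∀ {k} (H : Cover graph k) (α : A → Permutation′ k) (β : B → Permutation′ k) →
            (∀ a b → inc a b ≡ true → ∀ i →
              M H (from (inj₁ a)) (from (inj₂ b)) (α a ⟨$⟩ʳ i) (β b ⟨$⟩ʳ i) ≡ false) →
            Packing H
  packing {k} H α β ok = record
    { col       = λ i v → γ (to v) ⟨$⟩ʳ i
    ; colouring = λ i u v → subst₂ (λ x y → M H x y (γ (to u) ⟨$⟩ʳ i) (γ (to v) ⟨$⟩ʳ i) ≡ false)
                              (strictlyInverseʳ u) (strictlyInverseʳ v) (independent i (to u) (to v))
    ; disjoint  = λ i j v → permutation-injective (γ (to v))
    }
    where
    γ : A ⊎ B → Permutation′ k
    γ = [ α , β ]′
    non-incident : ∀ x y i j → incident x y ≡ false → M H (from x) (from y) i j ≡ false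
    non-incident x y i j eq = nonEdge H _ _ i j
      (trans (cong₂ incident (strictlyInverseˡ x) (strictlyInverseˡ y)) eq)
    forward : ∀ i a b → M H (from (inj₁ a)) (from (inj₂ b)) (α a ⟨$⟩ʳ i) (β b ⟨$⟩ʳ i) ≡ false
    forward i a b with inc a b in eq
    ... | true  = ok a b eq i
    ... | false = non-incident (inj₁ a) (inj₂ b) _ _ eq
    independent : ∀ i x y → M H (from x) (from y) (γ x ⟨$⟩ʳ i) (γ y ⟨$⟩ʳ i) ≡ false
    independent i (inj₁ a) (inj₁ a′) = non-incident (inj₁ a) (inj₁ a′) _ _ refl
    independent i (inj₁ a) (inj₂ b)  = forward i a b
    independent i (inj₂ b) (inj₁ a)  = trans (symm H _ _ _ _) (forward i a b)
    independent i (inj₂ b) (inj₂ b′) = non-incident (inj₂ b) (inj₂ b′) _ _ refl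

-- Upper bounds for graphs of stars with common hubs

-- Hubs inj₁ y and star centres inj₂ g on one side, the leaves (g , q) on the
-- other: a leaf is joined to all d hubs and to the centre of its own star.
module Stars (d N m : ℕ) where

  inc : Fin d ⊎ Fin N → Fin N × Fin m → Bool
  inc (inj₁ y) _        = true
  inc (inj₂ g) (g′ , q) = ⌊ g ≟ g′ ⌋

  open Bipartite {size = (d + N) + N * m} ((+↔⊎ ⊎-↔ *↔×) ↔-∘ +↔⊎) inc public

  private
    from′ = Inverse.from ((+↔⊎ {d} {N} ⊎-↔ *↔× {N} {m}) ↔-∘ +↔⊎)

  module _ {k : ℕ} (H : Cover graph k) where

    X : Fin N × Fin m → Fin k → Fin k → Bool
    X w = M H (from′ (inj₁ (inj₂ (proj₁ w)))) (from′ (inj₂ w))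

    Y : Fin N × Fin m → Family d k
    Y w y = M H (from′ (inj₁ (inj₁ y))) (from′ (inj₂ w))

    module Leaf (w : Fin N × Fin m) = Twist (X w) (Y w)
      (matchˡ H _ _) (matchʳ H _ _) (λ y → matchˡ H _ _) (λ y → matchʳ H _ _)

    LeafBlock : Fin N × Fin m → Permutation′ k → Set
    LeafBlock w = Leaf.TwistBlock w

    Extension : Fin N × Fin m → Permutation′ k → Set
    Extension w π = ∃ λ (β : Permutation′ k) → ∀ l i → twisted (X w) (Y w) π l i (β ⟨$⟩ʳ i) ≡ false

    extend : ∀ w π → LeafBlock w π ⊎ Extension w π
    extend w π = Avoidance.avoid (twisted (X w) (Y w) π) (Leaf.twistedˡ w π) (Leaf.twistedʳ w π)

    -- Leaves are pairwise non-adjacent, so once hubs and centres are fixed each leaf can be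
    -- extended separately.
    star-packing : (π : Fin N → Permutation′ k) → (∀ w → Extension w (π (proj₁ w))) → Packing H
    star-packing π leaf = packing H α (λ w → proj₁ (leaf w)) ok
      where
      α : Fin d ⊎ Fin N → Permutation′ k
      α = [ (λ _ → idₚ) , π ]′
      ok : ∀ a w → inc a w ≡ true → ∀ i →
           M H (from′ (inj₁ a)) (from′ (inj₂ w)) (α a ⟨$⟩ʳ i) (proj₁ (leaf w) ⟨$⟩ʳ i) ≡ false
      ok (inj₁ y) w        _  i = proj₂ (leaf w) (suc y) i
      ok (inj₂ g) (g′ , q) eq i with refl ← ⌊⌋-true (g ≟ g′) eq = proj₂ (leaf (g , q)) zero i

    module _ (k≡ : k ≡ suc (d + d)) (2≤d : 2 ≤ d) where

      -- Records the outcome of `extend` rather than the absence of an extension, so that either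
      -- answer carries a witness: a block or a permutation at the leaf.
      blocked : Fin N × Fin m → Code k → Bool
      blocked w p = [ (λ _ → true) , (λ _ → false) ]′ (extend w (perm p))

      block : ∀ w p → blocked w p ≡ true → LatinBlock (twisted (X w) (Y w) (perm p))
      block w p eq with extend w (perm p)
      ... | inj₁ b = latin _ (Leaf.twistedˡ w (perm p)) (Leaf.twistedʳ w (perm p)) k≡ b

      -- All blocked permutations agree with one of them on the rows `S` of its block, and `S`
      -- misses at most `d` positions.
      tally-blocked : ∀ w → tally (blocked w) ≤ d !
      tally-blocked w with tally (blocked w) ℕ.≟ 0
      ... | yes ≡0 = ℕ.≤-trans (ℕ.≤-reflexive ≡0) z≤n
      ... | no ≢0 = bound (member _ ≢0)
        where
        bound : (∃ λ p → blocked w p ≡ true) → tally (blocked w) ≤ d !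
        bound (p₀ , B₀) = ℕ.≤-trans (tally-agree (blocked w) (not ∘ LatinBlock.S b₀) agree) (!-mono (LatinBlock.S-large b₀))
          where
          b₀ = block w p₀ B₀
          with-p₀ : ∀ p → blocked w p ≡ true → ∀ i → LatinBlock.S b₀ i ≡ true → perm p₀ ⟨$⟩ʳ i ≡ perm p ⟨$⟩ʳ i
          with-p₀ p Bp = Leaf.blocks-agree w k≡ 2≤d b₀ (block w p Bp)
          agree : ∀ p q → blocked w p ≡ true → blocked w q ≡ true → ∀ i → not (LatinBlock.S b₀ i) ≡ false →
                  perm p ⟨$⟩ʳ i ≡ perm q ⟨$⟩ʳ i
          agree p q Bp Bq i Ui = trans (sym (with-p₀ p Bp i Si)) (with-p₀ q Bq i Si)
            where
            Si = Bool.not-injective {y = true} Ui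
          !-mono : ∀ {a b} → a ≤ b → a ! ≤ b !
          !-mono {b = b} z≤n = ℕ.1≤n! b
          !-mono (s≤s a≤b) = ℕ.*-mono-≤ (s≤s a≤b) (!-mono a≤b)

      unblocked : ∀ w p → blocked w p ≡ false → Extension w (perm p)
      unblocked w p eq with extend w (perm p)
      ... | inj₂ β = β

  packable-even : Packable graph (suc (suc (d + d)))
  packable-even H = star-packing H (λ _ → idₚ) λ w → [ ⊥-elim ∘ no-block w , id ]′ (extend H w idₚ)
    where
    no-block : ∀ w → ¬ LeafBlock H w idₚ
    no-block w = Avoidance.no-block (twisted (X H w) (Y H w) idₚ) (Leaf.twistedˡ H w idₚ) (Leaf.twistedʳ H w idₚ)
      (ℕ.≤-reflexive (cong suc (ℕ.+-suc d d)))

  -- Each leaf constrains only its own centre, so the stars are independent, and the `m` leaves of a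
  -- star exclude at most `m * d !` permutations.
  packable-odd : 2 ≤ d → m * d ! < suc (d + d) ! → Packable graph (suc (d + d))
  packable-odd 2≤d few H = star-packing H (perm ∘ proj₁ ∘ good) λ w →
    unblocked H refl 2≤d w _ (proj₂ (good (proj₁ w)) (proj₂ w))
    where
    good : ∀ g → ∃ λ p → ∀ q → blocked H refl 2≤d (g , q) p ≡ false
    good g = avoid-all (λ q → blocked H refl 2≤d (g , q)) (λ q → tally-blocked H refl 2≤d (g , q)) few

-- Covers without a packing

-- Fix s + 1 colourings of a packing. On them, the hubs and the centre of a star carry d + 1
-- injections into the k = s + 1 + d colours. Some star and leaf see exactly these injections,
-- turned into a Latin rectangle: in the s + 1 fixed colourings that leaf may only use the
-- k ∸ (d + 1) = s colours outside the rectangle.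
module LowerBound (d s : ℕ) (s≤d : s ≤ d) where

  private
    k = suc s + d
    f = fall k (suc s)

  -- One star for each choice of `d` injections on the hubs and, in each star, one leaf for each
  -- injection on its centre.
  open Stars d (f ^ d) f

  colour : Fin (suc d) → Fin k
  colour t = inject≤ t (s≤s (ℕ.m≤n+m d s))

  colour-injective : Injective _≡_ _≡_ colour
  colour-injective = inject≤-injective _ _ _ _

  -- The colour that neighbour `l` forbids at the leaf in colouring `r`. Each row exhausts the first
  -- `d + 1` colours; distinctness within a column makes the links matchings.
  rectangle : Fin (suc s) → Fin (suc d) → Fin k
  rectangle r l = colour (cyclic (inject≤ r (s≤s s≤d)) l)

  rectangle-injective : ∀ l → Injective _≡_ _≡_ (λ r → rectangle r l)
  rectangle-injective l {r} {r′} eq = inject≤-injective _ _ _ _ (cyclic-injective l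
    (trans (cyclic-comm l _) (trans (colour-injective eq) (cyclic-comm _ l))))

  -- `Q r` is the colour that neighbour `l` is expected to use in colouring `r`.
  Link : (Fin (suc s) → Fin k) → Fin (suc d) → Fin k → Fin k → Set
  Link Q l i j = ∃ λ r → Q r ≡ i × rectangle r l ≡ j

  link? : ∀ Q l i j → Dec (Link Q l i j)
  link? Q l i j = any? λ r → Q r ≟ i ×-dec rectangle r l ≟ j

  linkˡ : ∀ Q → Injective _≡_ _≡_ Q → ∀ l i j j′ → ⌊ link? Q l i j ⌋ ≡ true → ⌊ link? Q l i j′ ⌋ ≡ true → j ≡ j′
  linkˡ Q Q-inj l i j j′ p p′ with r , refl , refl ← ⌊⌋-true (link? Q l i j) p
                              with r′ , eq , refl ← ⌊⌋-true (link? Q l (Q r) j′) p′ =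
    cong (λ r → rectangle r l) (sym (Q-inj eq))

  linkʳ : ∀ Q l i i′ j → ⌊ link? Q l i j ⌋ ≡ true → ⌊ link? Q l i′ j ⌋ ≡ true → i ≡ i′
  linkʳ Q l i i′ j p p′ with r , refl , refl ← ⌊⌋-true (link? Q l i j) p
                        with r′ , refl , eq ← ⌊⌋-true (link? Q l i′ (rectangle r l)) p′ =
    cong Q (sym (rectangle-injective l eq))

  injection : Fin f → Fin (suc s) → Fin k
  injection = decode k (suc s)

  -- The star number `g` is read as a string of `d` digits, one injection per hub; the leaf number
  -- `q` encodes the injection of the centre.
  K : Fin d ⊎ Fin (f ^ d) → Fin (f ^ d) × Fin f → Fin k → Fin k → Bool
  K (inj₁ y) (g , q)  i j = ⌊ link? (injection (finToFun g y)) (suc y) i j ⌋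
  K (inj₂ g) (g′ , q) i j = ⌊ g ≟ g′ ⌋ ∧ ⌊ link? (injection q) zero i j ⌋

  K-inc : ∀ a b i j → inc a b ≡ false → K a b i j ≡ false
  K-inc (inj₂ g) (g′ , q) i j eq = cong (_∧ ⌊ link? (injection q) zero i j ⌋) eq

  Kˡ : ∀ a b i j j′ → K a b i j ≡ true → K a b i j′ ≡ true → j ≡ j′
  Kˡ (inj₁ y) (g , q)  i j j′ p p′ = linkˡ _ (decode-injective k (suc s) (finToFun g y)) (suc y) i j j′ p p′
  Kˡ (inj₂ g) (g′ , q) i j j′ p p′ = linkˡ _ (decode-injective k (suc s) q) zero i j j′
    (Bool.∧-conicalʳ ⌊ g ≟ g′ ⌋ _ p) (Bool.∧-conicalʳ ⌊ g ≟ g′ ⌋ _ p′)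

  Kʳ : ∀ a b i i′ j → K a b i j ≡ true → K a b i′ j ≡ true → i ≡ i′
  Kʳ (inj₁ y) (g , q)  i i′ j p p′ = linkʳ (injection (finToFun g y)) (suc y) i i′ j p p′
  Kʳ (inj₂ g) (g′ , q) i i′ j p p′ = linkʳ (injection q) zero i i′ j
    (Bool.∧-conicalʳ ⌊ g ≟ g′ ⌋ _ p) (Bool.∧-conicalʳ ⌊ g ≟ g′ ⌋ _ p′)

  H₀ : Cover graph k
  H₀ = cover K K-inc Kˡ Kʳ

  no-packing : ¬ Packing H₀
  -- The leaf's `s + 1` colours and the `d + 1` forbidden ones would be disjoint among `s + 1 + d`
  -- colours.
  no-packing P = ℕ.<-irrefl refl (ℕ.≤-trans (ℕ.≤-reflexive (cong suc (sym (ℕ.+-suc s d))))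
    (disjoint-injections leaf-injective colour-injective avoids))
    where
    place = Inverse.from ((+↔⊎ {d} {f ^ d} ⊎-↔ *↔× {f ^ d} {f}) ↔-∘ +↔⊎)
    seen : Fin d ⊎ Fin (f ^ d) → Fin (suc s) → Fin k
    seen a r = col P (r ↑ˡ d) (place (inj₁ a))
    code : ∀ a → ∃ λ q → ∀ r → injection q r ≡ seen a r
    code a = decode-onto k (suc s) (seen a) λ eq → ↑ˡ-injective d _ _ (disjoint P _ _ _ eq)
    -- The hubs determine the star; only then is the injection at its centre read off to select the
    -- leaf.
    g : Fin (f ^ d)
    g = funToFin λ y → proj₁ (code (inj₁ y))
    q : Fin f
    q = proj₁ (code (inj₂ g))
    leaf : Fin (suc s) → Fin k
    leaf r = col P (r ↑ˡ d) (place (inj₂ (g , q)))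
    leaf-injective : Injective _≡_ _≡_ leaf
    leaf-injective eq = ↑ˡ-injective d _ _ (disjoint P _ _ _ eq)
    independent : ∀ a r → K a (g , q) (seen a r) (leaf r) ≡ false
    independent a r = trans (sym (cover-edge K K-inc Kˡ Kʳ a (g , q) (seen a r) (leaf r))) (colouring P (r ↑ˡ d) _ _)
    hit : ∀ l r → leaf r ≢ rectangle r l
    hit zero r eq = contradiction
      (trans (sym (cong₂ _∧_ (⌊⌋-intro (g ≟ g) refl)
        (⌊⌋-intro (link? (injection q) zero _ _) (r , proj₂ (code (inj₂ g)) r , sym eq))))
        (independent (inj₂ g) r)) λ ()
    hit (suc y) r eq = contradiction
      (trans (sym (⌊⌋-intro (link? (injection (finToFun g y)) (suc y) _ _)
        (r , trans (cong (λ q → injection q r) (finToFun-funToFin _ y)) (proj₂ (code (inj₁ y)) r) , sym eq)))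
        (independent (inj₁ y) r)) λ ()
    avoids : ∀ r t → leaf r ≢ colour t
    -- Row `r` of the cyclic square contains `t`, so some neighbour `l` forbids it.
    avoids r t eq with l , refl ← injective⇒surjective (cyclic (inject≤ r (s≤s s≤d))) (cyclic-injective (inject≤ r (s≤s s≤d))) t =
      hit l r eq

-- Parity and the missing value 3

-- A permutation of three colours is even when it sends 0, 1 to cyclically consecutive colours.
consecutive : Fin 3 → Fin 3 → Bool
consecutive 0F 1F = true
consecutive 1F 2F = true
consecutive 2F 0F = true
consecutive _  _  = false

swap₀₁ : Fin 3 → Fin 3
swap₀₁ 0F = 1F
swap₀₁ 1F = 0F
swap₀₁ 2F = 2F

-- The quotient of the two permutations has no fixed point, so it is a 3-cycle and even. The proof
-- checks all cases.
parity-equal : ∀ x₀ x₁ x₂ y₀ y₁ y₂ → x₀ ≢ x₁ → x₀ ≢ x₂ → x₁ ≢ x₂ → y₀ ≢ y₁ → y₀ ≢ y₂ → y₁ ≢ y₂ →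
               x₀ ≢ y₀ → x₁ ≢ y₁ → x₂ ≢ y₂ → consecutive x₀ x₁ ≡ consecutive y₀ y₁
parity-equal = toWitness {a? = all? λ x₀ → all? λ x₁ → all? λ x₂ → all? λ y₀ → all? λ y₁ → all? λ y₂ →
  ¬? (x₀ ≟ x₁) →-dec (¬? (x₀ ≟ x₂) →-dec (¬? (x₁ ≟ x₂) →-dec (¬? (y₀ ≟ y₁) →-dec (¬? (y₀ ≟ y₂) →-dec (¬? (y₁ ≟ y₂) →-dec
  (¬? (x₀ ≟ y₀) →-dec (¬? (x₁ ≟ y₁) →-dec (¬? (x₂ ≟ y₂) →-dec (consecutive x₀ x₁ Bool.≟ consecutive y₀ y₁)))))))))} _

swap₀₁-involutive : ∀ i → swap₀₁ (swap₀₁ i) ≡ i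
swap₀₁-involutive 0F = refl
swap₀₁-involutive 1F = refl
swap₀₁-involutive 2F = refl

swap₀₁-injective : Injective _≡_ _≡_ swap₀₁
swap₀₁-injective {i} {j} eq = trans (sym (swap₀₁-involutive i)) (trans (cong swap₀₁ eq) (swap₀₁-involutive j))

consecutive-swap : ∀ x y → x ≢ y → consecutive (swap₀₁ x) (swap₀₁ y) ≡ not (consecutive x y)
consecutive-swap = toWitness {a? = all? λ x → all? λ y →
  ¬? (x ≟ y) →-dec (consecutive (swap₀₁ x) (swap₀₁ y) Bool.≟ not (consecutive x y))} _

-- Two permutations of three colours that agree nowhere have the same parity. Hence a
-- packing of the 3-fold cover that puts a transposition on the edges where a 2-fold
-- cover is straight, and the identity elsewhere, yields a packing of the 2-fold cover.
packable-3⇒2 : ∀ {G} → Packable G 3 → Packable G 2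
packable-3⇒2 {G} pack H = record
  { col       = λ a v → side a (parity v)
  ; colouring = independent
  ; disjoint  = λ a b v → side-injective (parity v) a b
  }
  where
  -- A matching between two lists of size 2 lies in the straight or in the crossed one; an empty one
  -- counts as crossed. Straight edges call for different sides, crossed ones for equal sides.
  straight : Fin (n G) → Fin (n G) → Bool
  straight u v = M H u v 0F 0F ∨ M H u v 1F 1F

  twist : Bool → Fin 3 → Fin 3
  twist false = id
  twist true  = swap₀₁

  twist-injective : ∀ b → Injective _≡_ _≡_ (twist b)
  twist-injective false eq = eq
  twist-injective true  eq = swap₀₁-injective eq

  twist-involutive : ∀ b i → twist b (twist b i) ≡ i
  twist-involutive false _ = refl
  twist-involutive true  i = swap₀₁-involutive i

  straight-sym : ∀ u v → straight u v ≡ straight v u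
  straight-sym u v = cong₂ _∨_ (symm H u v 0F 0F) (symm H u v 1F 1F)

  edge : Bool → Bool → Fin 3 → Fin 3 → Bool
  edge e b i j = e ∧ ⌊ i ≟ twist b j ⌋

  edge⇒≡ : ∀ e b i j → edge e b i j ≡ true → i ≡ twist b j
  edge⇒≡ true b i j p = ⌊⌋-true (i ≟ twist b j) p

  edge-swap : ∀ e b i j → edge e b i j ≡ true → edge e b j i ≡ true
  edge-swap true b i j p = ⌊⌋-intro (j ≟ twist b i)
    (trans (sym (twist-involutive b j)) (cong (twist b) (sym (⌊⌋-true (i ≟ twist b j) p))))

  edge-sym : ∀ e b i j → edge e b i j ≡ edge e b j i
  edge-sym e b i j with edge e b i j in p | edge e b j i in q
  ... | true  | true  = refl
  ... | false | false = refl
  ... | true  | false = trans (sym (edge-swap e b i j p)) q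
  ... | false | true  = trans (sym p) (edge-swap e b j i q)

  H₃ : Cover G 3
  H₃ = record
    { M       = λ u v → edge (adj G u v) (straight u v)
    ; symm    = λ u v i j → trans (cong₂ (λ e b → edge e b i j) (adj-sym G u v) (straight-sym u v))
                                  (edge-sym (adj G v u) (straight v u) i j)
    ; nonEdge = λ u v i j eq → cong (_∧ ⌊ i ≟ twist (straight u v) j ⌋) eq
    ; matchˡ  = λ u v i j j′ p q → twist-injective (straight u v)
                  (trans (sym (edge⇒≡ (adj G u v) (straight u v) i j p)) (edge⇒≡ (adj G u v) (straight u v) i j′ q))
    ; matchʳ  = λ u v i i′ j p q → trans (edge⇒≡ (adj G u v) (straight u v) i j p) (sym (edge⇒≡ (adj G u v) (straight u v) i′ j q))
    }

  P : Packing H₃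
  P = pack H₃

  parity : Fin (n G) → Bool
  parity v = consecutive (col P 0F v) (col P 1F v)

  distinct : ∀ {a b} v → a ≢ b → col P a v ≢ col P b v
  distinct v a≢b = a≢b ∘ disjoint P _ _ v

  -- In `H₃` every edge of `G` carries a perfect matching, so the permutation at `u` agrees nowhere
  -- with the twisted one at `v`.
  parity-edge : ∀ u v b → adj G u v ≡ true → straight u v ≡ b →
                parity u ≡ consecutive (twist b (col P 0F v)) (twist b (col P 1F v))
  parity-edge u v b uv refl = parity-equal _ _ _ _ _ (twist b (col P 2F v))
    (distinct u λ ()) (distinct u λ ()) (distinct u λ ())
    (distinct v (λ ()) ∘ twist-injective b) (distinct v (λ ()) ∘ twist-injective b) (distinct v (λ ()) ∘ twist-injective b)
    (apart 0F) (apart 1F) (apart 2F)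
    where
    apart : ∀ a → col P a u ≢ twist b (col P a v)
    apart a eq = contradiction
      (trans (sym (cong₂ _∧_ uv (⌊⌋-intro (col P a u ≟ twist b (col P a v)) eq))) (colouring P a u v)) λ ()

  -- Addition modulo 2 of the colouring's index and the parity.
  side : Fin 2 → Bool → Fin 2
  side 0F false = 0F
  side 0F true  = 1F
  side 1F false = 1F
  side 1F true  = 0F

  side-injective : ∀ p a b → side a p ≡ side b p → a ≡ b
  side-injective _     0F 0F _ = refl
  side-injective _     1F 1F _ = refl
  side-injective false 0F 1F ()
  side-injective true  0F 1F ()
  side-injective false 1F 0F ()
  side-injective true  1F 0F ()

  crooked-edge : ∀ u v → straight u v ≡ false → ∀ i → M H u v i i ≡ false
  crooked-edge u v eq 0F = Bool.∨-conicalˡ (M H u v 0F 0F) _ eq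
  crooked-edge u v eq 1F = Bool.∨-conicalʳ (M H u v 0F 0F) _ eq

  straight-edge : ∀ u v → straight u v ≡ true → ∀ i j → i ≢ j → M H u v i j ≡ false
  straight-edge u v eq i j i≢j with M H u v i j in Mij
  ... | false = refl
  ... | true  = ⊥-elim (cases (M H u v 0F 0F) refl)
    where
    clash : ∀ x → M H u v x x ≡ true → ∀ i j → M H u v i j ≡ true → i ≢ j → ⊥
    clash 0F p 0F j  q i≢j = i≢j (matchˡ H u v _ _ _ p q)
    clash 0F p 1F 0F q i≢j = i≢j (matchʳ H u v _ _ _ q p)
    clash 0F p 1F 1F q i≢j = i≢j refl
    clash 1F p 1F j  q i≢j = i≢j (matchˡ H u v _ _ _ p q)
    clash 1F p 0F 1F q i≢j = i≢j (matchʳ H u v _ _ _ q p)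
    clash 1F p 0F 0F q i≢j = i≢j refl
    cases : ∀ b → M H u v 0F 0F ≡ b → ⊥
    cases true  p = clash 0F p i j Mij i≢j
    cases false p = clash 1F (trans (cong (_∨ M H u v 1F 1F) (sym p)) eq) i j Mij i≢j

  side-not : ∀ a p → side a (not p) ≢ side a p
  side-not 0F false ()
  side-not 0F true  ()
  side-not 1F false ()
  side-not 1F true  ()

  independent : ∀ a → IsColouring H (λ v → side a (parity v))
  independent a u v = cases (adj G u v) (straight u v) refl refl
    where
    cases : ∀ e b → adj G u v ≡ e → straight u v ≡ b → M H u v (side a (parity u)) (side a (parity v)) ≡ false
    cases false _ uv _ = nonEdge H u v _ _ uv
    cases true false uv st =
      trans (cong (λ p → M H u v (side a p) (side a (parity v))) (parity-edge u v false uv st))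
            (crooked-edge u v st (side a (parity v)))
    cases true true uv st = straight-edge u v st _ _ λ eq → side-not a (parity v)
      (trans (sym (cong (side a) (trans (parity-edge u v true uv st)
        (consecutive-swap _ _ (distinct v λ ()))))) eq)

-- The values attained

point : Graph
point = record { n = 1 ; adj = λ _ _ → false ; irrefl = λ _ → refl ; sym = λ _ _ → refl }

point-1 : IsCorrPackingNumber point 1
point-1 = s≤s z≤n ,
  (λ H → record { col = λ a _ → a ; colouring = λ _ u v → nonEdge H u v _ _ refl ; disjoint = λ _ _ _ eq → eq }) ,
  λ { zero () _ ; (suc j) _ (s≤s ()) }

-- The lower bound is taken with `s = d`, which refutes packings with `2d + 1` colours.
even-number : ∀ d → IsCorrPackingNumber (Stars.graph d (fall (suc (d + d)) (suc d) ^ d) (fall (suc (d + d)) (suc d)))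
                                        (suc (suc (d + d)))
even-number d = packing-number (Stars.packable-even d _ _) λ pack →
  LowerBound.no-packing d d ℕ.≤-refl (pack (LowerBound.H₀ d d ℕ.≤-refl))

-- Here `s` is one less than the number `d` of hubs, which refutes `2d` colours. The `(2d)! / d!`
-- leaves of a star exclude at most `(2d)!` of the `(2d + 1)!` permutations.
odd-number : ∀ d → 2 ≤ d → IsCorrPackingNumber (Stars.graph d (fall (d + d) d ^ d) (fall (d + d) d)) (suc (d + d))
odd-number (suc d) 2≤d = packing-number (Stars.packable-odd (suc d) _ _ 2≤d few) λ pack →
  LowerBound.no-packing (suc d) d (ℕ.n≤1+n d) (pack (LowerBound.H₀ (suc d) d (ℕ.n≤1+n d)))
  where
  k = suc d + suc d
  few : fall k (suc d) * suc d ! < suc k !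
  few = ℕ.≤-<-trans (ℕ.≤-reflexive (fall-! (suc d) (suc d)))
    (ℕ.≤-trans (ℕ.+-monoˡ-≤ (k !) (ℕ.1≤n! k)) (ℕ.+-monoʳ-≤ (k !) (ℕ.m≤m+n (k !) _)))

parity-of : ∀ k → ∃ λ d → k ≡ d + d ⊎ k ≡ suc (d + d)
parity-of zero = zero , inj₁ refl
parity-of (suc k) with parity-of k
... | d , inj₁ refl = d , inj₂ refl
... | d , inj₂ refl = suc d , inj₁ (cong suc (sym (ℕ.+-suc d d)))

theorem1 : ((z : ℕ) → 1 ≤ z → z ≢ 3 → Σ Graph (λ G → IsCorrPackingNumber G z))
    × ¬ (Σ Graph (λ G → IsCorrPackingNumber G 3))
theorem1 = exists , λ { (G , _ , pack , minimal) →
    minimal 2 (s≤s z≤n) (s≤s (s≤s (s≤s z≤n))) (packable-3⇒2 pack) }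
  where
  exists : (z : ℕ) → 1 ≤ z → z ≢ 3 → Σ Graph (λ G → IsCorrPackingNumber G z)
  -- The case split is on the parity of `z ∸ 1`, so the even cases produce odd values of `z`.
  exists (suc k) _ z≢3 with parity-of k
  ... | zero        , inj₁ refl = point , point-1
  ... | suc zero    , inj₁ refl = contradiction refl z≢3
  ... | suc (suc d) , inj₁ refl = _ , odd-number (suc (suc d)) (s≤s (s≤s z≤n))
  ... | d           , inj₂ refl = _ , even-number d
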